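{- For all $L\in\mathbf N$, $$\sum_{k=0}^L q^{T(k)}\begin{bmatrix} L\\ k\end{bmatrix}_q(-q)_k=\sum_{j=-\infty}^\infty (-1)^j q^{2j(3j+1)}\begin{bmatrix} 2L+1\\ L-3j\end{bmatrix}_q .$$
   Context: $\mathbf N$ denotes the set of nonnegative integers. For $m\in\mathbf N$, $(a)_m=(a;q)_m=\prod_{j=0}^{m-1}(1-aq^j)$, so $(q)_m=\prod_{j=1}^m(1-q^j)$ and $(-q)_m=\prod_{j=1}^m(1+q^j)$, with $(a)_0=1$. The $q$-binomial coefficient is $\begin{bmatrix} m+n\\ m\end{bmatrix}_q=\frac{(q)_{m+n}}{(q)_m(q)_n}$ if $m,n\in\mathbf N$, and it is $0$ otherwise (so $\begin{bmatrix} A\\ B\end{bmatrix}_q=0$ unless $0\le B\le A$). For $j\in\mathbb Z$, $T(j)=\frac{j(j+1)}{2}$. -}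

module Defs where

open import Algebra.Bundles using (CommutativeRing; Semiring)
open import Data.Fin.Base using (toℕ)
open import Data.Integer.Base as ℤ using (ℤ; +_; -[1+_]; ∣_∣)
open import Data.Nat.Base as ℕ using (ℕ; suc)
open import Data.Nat.DivMod using (_/_)
open import Data.Product.Base using (∃-syntax; _×_; proj₁)
import Algebra.Definitions
import Algebra.Definitions.RawSemiring

-- The product j (j + 1) is nonnegative and even for every integer j, so
-- neither ∣_∣ nor the truncating division loses information.
T : ℤ → ℕ
T j = ∣ j ℤ.* (j ℤ.+ + 1) ∣ / 2

module Pochhammer {c ℓ} (R : CommutativeRing c ℓ)
                  (q : CommutativeRing.Carrier R) where

  open CommutativeRing R
  open Algebra.Definitions _≈_ using (Invertible)
  open Algebra.Definitions.RawSemiring (Semiring.rawSemiring semiring) public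
    using (_^_; sum; product)

  -- (a)_m = (a; q)_m
  poch : Carrier → ℕ → Carrier
  poch a m = product {m} λ j → 1# - a * q ^ toℕ j

  -- The standing assumption under which quotients by (q)_m make sense.  It
  -- holds for q an indeterminate (in ℤ[[q]] or ℚ(q)), and for any element of
  -- a field with qⁿ ≠ 1 for all n ≥ 1, e.g. q ∈ ℂ with |q| < 1.
  Admissible : Set _
  Admissible = ∀ m → Invertible 1# _*_ (poch q m)

  ∑≤ : ℕ → (ℕ → Carrier) → Carrier
  ∑≤ n f = sum {suc n} λ i → f (toℕ i)

  -- ∑_{j = -N}^{N} f j
  ∑± : ℕ → (ℤ → Carrier) → Carrier
  ∑± N f = ∑≤ (N ℕ.+ N) λ i → f (+ i ℤ.- + N)

  infix 4 _≈∑ℤ_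

  -- s = ∑_{j = -∞}^{∞} f j, for a family f of finite support.
  _≈∑ℤ_ : Carrier → (ℤ → Carrier) → Set _
  s ≈∑ℤ f = ∃[ N ] (∀ j → N ℕ.< ∣ j ∣ → f j ≈ 0#) × s ≈ ∑± N f

  module QBinomial (adm : Admissible) where

    1/poch-q : ℕ → Carrier
    1/poch-q m = proj₁ (adm m)

    -- The q-binomial coefficient with upper entry m + n and lower entry m,
    -- for integers m and n.
    qbinom-+ : ℤ → ℤ → Carrier
    qbinom-+ (+ m)    (+ n)    = poch q (m ℕ.+ n) * (1/poch-q m * 1/poch-q n)
    qbinom-+ (+ _)    -[1+ _ ] = 0#
    qbinom-+ -[1+ _ ] _        = 0#

    -- Upper entry A, lower entry B.
    qbinom : ℤ → ℤ → Carrier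
    qbinom A B = qbinom-+ B (A ℤ.- B)

{-# OPTIONS --safe #-}
module Submission where

open import Defs
open import Algebra.Bundles using (CommutativeRing)
open import Data.Integer.Base as ℤ using (ℤ; +_; -[1+_]; ∣_∣; 0ℤ; 1ℤ)
open import Data.Nat.Base as ℕ using (ℕ; zero; suc; z≤n; s≤s)
import Algebra.Properties.Ring as RingProperties
import Algebra.Properties.Semiring.Exp as Exponentiation
import Algebra.Properties.Semiring.Sum as Summation
import Algebra.Solver.Ring.NaturalCoefficients.Default as SemiringSolver
import Data.Integer.Properties as ℤ
import Data.Integer.Tactic.RingSolver as ℤ-Solver
import Data.Nat.Properties as ℕ
open import Data.Nat.Divisibility using (divides)
open import Data.Nat.DivMod using (_/_; +-distrib-/-∣ˡ; m*n/n≡m)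
open import Data.Fin.Base using (toℕ)
open import Data.Product.Base using (∃-syntax; _,_; proj₁; proj₂)
open import Function.Base using (_∘_)
open import Relation.Binary.PropositionalEquality.Core as ≡ using (_≡_)

-- Write p = qᴸ.  Both sides equal 1 at L = 0 and satisfy the recurrence
--   S(L+1) + q S(L-1) = (1 + q + q²p²) S(L) + q p² S(L-1),
-- in which p = 1 makes the terms S(L-1) cancel when L = 0.
--
-- Left side: with V(L) the sum with an extra factor qᵏ, Pascal's rule gives
--   S(L+1) = (1 + qp) S(L) + q²p V(L),   V(L+1) + qp V(L) = V(L) + qp S(L+1),
-- and V is eliminated.
--
-- Right side: let H_β(m, n) = ∑_j (-1)ʲ q^{6j²+βj} [m+n over m], where with
-- x = L - 3j and y = L + 3j the pair (m, n) is (x, y) for e, (x-1, y+1) for f,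
-- (x-1, y+2) for g, (x, y+1) for h, (x-1, y) for previous and (x+1, y+2) for next;
-- thus next and previous are h₂ for L + 1 and L - 1.  Pascal's rule and the reflections j ↦ -j and
-- j ↦ -1 - j give, with each name standing for its sum over j and the subscript for β
-- (β = 2 in next and previous),
--   next = (1 + q²p²) h₂ + qp h₁ + q²p g₅,   previous + p e₁ = e₂ + p² previous,
--   h₁ = e₁ + qp f₄,   h₂ = e₂ + qp f₅,   g₅ + p f₄ = f₅,
-- and the recurrence is a linear combination of these.

module GaussianBinomials {c ℓ} (R : CommutativeRing c ℓ) (q : CommutativeRing.Carrier R)
                         (adm : Pochhammer.Admissible R q) where

  open CommutativeRing R
  open Pochhammer R q
  open QBinomial adm
  open RingProperties ring using (-‿distribˡ-*; -‿involutive; -1*x≈-x; +-cancelʳ)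
  open Exponentiation semiring using (^-homo-*)
  open SemiringSolver commutativeSemiring using (solve; _:+_; _:*_; _:=_; con)
  open import Relation.Binary.Reasoning.Setoid setoid

  -- A negative exponent only ever multiplies a vanishing binomial, so ∣_∣ is harmless.
  q^_ : ℤ → Carrier
  q^ e = q ^ ∣ e ∣
  infix 9 q^_

  q^-+ : ∀ {a b} → 0ℤ ℤ.≤ a → 0ℤ ℤ.≤ b → q^ (a ℤ.+ b) ≈ q^ a * q^ b
  q^-+ {+ a} {+ b} _ _ = ^-homo-* q a b

  -- The products `poch q m`, their inverses, and the symmetry of Gaussian binomials.

  product-snoc : ∀ m (f : ℕ → Carrier) →
    product {suc m} (λ j → f (toℕ j)) ≈ product {m} (λ j → f (toℕ j)) * f m
  product-snoc zero    f = *-comm _ _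
  product-snoc (suc m) f = trans (*-congˡ (product-snoc m (λ j → f (suc j)))) (sym (*-assoc _ _ _))

  poch-suc : ∀ a m → poch a (suc m) ≈ poch a m * (1# - a * q ^ m)
  poch-suc a m = product-snoc m (λ j → 1# - a * q ^ j)

  -- The inverses are separate witnesses for each `m`, so they are compared by inserting
  -- `poch q (suc m) * v ≈ 1#` and cancelling `u * poch q m`.
  1/poch-q-suc : ∀ m → 1/poch-q m ≈ (1# - q ^ suc m) * 1/poch-q (suc m)
  1/poch-q-suc m = begin
    u                     ≈⟨ *-identityʳ u ⟨
    u * 1#                ≈⟨ *-congˡ (proj₂ (proj₂ (adm (suc m)))) ⟨
    u * (poch q (suc m) * v)   ≈⟨ *-congˡ (*-congʳ (poch-suc q m)) ⟩
    u * (poch q m * d * v) ≈⟨ solve 4 (λ u p d v → u :* (p :* d :* v) := (u :* p) :* (d :* v)) refl u (poch q m) d v ⟩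
    (u * poch q m) * (d * v) ≈⟨ *-congʳ (proj₁ (proj₂ (adm m))) ⟩
    1# * (d * v)          ≈⟨ *-identityˡ _ ⟩
    d * v ∎
    where
    u = 1/poch-q m
    v = 1/poch-q (suc m)
    d = 1# - q ^ suc m

  1/poch-q-zero : 1/poch-q 0 ≈ 1#
  1/poch-q-zero = trans (sym (*-identityʳ _)) (proj₁ (proj₂ (adm 0)))

  qbinom-+-comm : ∀ m n → qbinom-+ m n ≈ qbinom-+ n m
  qbinom-+-comm (+ m)    (+ n)    = *-cong (reflexive (≡.cong (poch q) (ℕ.+-comm m n))) (*-comm _ _)
  qbinom-+-comm (+ _)    -[1+ _ ] = refl
  qbinom-+-comm -[1+ _ ] (+ _)    = refl
  qbinom-+-comm -[1+ _ ] -[1+ _ ] = refl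

  qbinom-+-cong : ∀ {m m′ n n′} → m ≡ m′ → n ≡ n′ → qbinom-+ m n ≈ qbinom-+ m′ n′
  qbinom-+-cong m≡m′ n≡n′ = reflexive (≡.cong₂ qbinom-+ m≡m′ n≡n′)

  qbinom-+-congʳ : ∀ m {n n′} → n ≡ n′ → qbinom-+ m n ≈ qbinom-+ m n′
  qbinom-+-congʳ m = qbinom-+-cong {m} ≡.refl

  qbinom-+-congˡ : ∀ {m m′} n → m ≡ m′ → qbinom-+ m n ≈ qbinom-+ m′ n
  qbinom-+-congˡ n m≡m′ = qbinom-+-cong {n = n} m≡m′ ≡.refl

  qbinom-+-0ˡ : ∀ n → qbinom-+ 0ℤ (+ n) ≈ 1#
  qbinom-+-0ˡ n = begin
    poch q n * (1/poch-q 0 * 1/poch-q n) ≈⟨ *-congˡ (*-congʳ 1/poch-q-zero) ⟩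
    poch q n * (1# * 1/poch-q n)         ≈⟨ *-congˡ (*-identityˡ _) ⟩
    poch q n * 1/poch-q n                ≈⟨ proj₂ (proj₂ (adm n)) ⟩
    1# ∎

  qbinom-+-0ʳ : ∀ m → qbinom-+ (+ m) 0ℤ ≈ 1#
  qbinom-+-0ʳ m = trans (qbinom-+-comm (+ m) 0ℤ) (qbinom-+-0ˡ m)

  -- Pascal's rules.

  1-ab : ∀ a b → (1# - a) + a * (1# - b) ≈ 1# - a * b
  1-ab a b = begin
    (1# - a) + a * (1# - b)         ≈⟨ solve 4 (λ a b a- b- → con 1 :+ a- :+ a :* (con 1 :+ b-) := con 1 :+ (a- :+ a) :+ a :* b-) refl a b (- a) (- b) ⟩
    1# + (- a + a) + a * - b        ≈⟨ +-cong (trans (+-congˡ (-‿inverseˡ a)) (+-identityʳ 1#)) (a*-b) ⟩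
    1# - a * b ∎
    where
    a*-b : a * - b ≈ - (a * b)
    a*-b = trans (*-comm _ _) (trans (sym (-‿distribˡ-* b a)) (-‿cong (*-comm b a)))

  -- For positive `m` and `n` this is `1-ab` at the powers of `q` with exponents `m` and `n`; on the
  -- rest of the boundary both sides are 0 or both are 1. At `m = n = 0` the left side would be 1
  -- and both terms on the right 0, which the hypothesis rules out.
  pascalˡ : ∀ {k} m n → m ℤ.+ n ≡ + suc k →
            qbinom-+ m n ≈ qbinom-+ (m ℤ.- 1ℤ) n + q^ m * qbinom-+ m (n ℤ.- 1ℤ)
  pascalˡ -[1+ m ] n        _ = sym (trans (+-identityˡ _) (zeroʳ _))
  pascalˡ (+ zero)  -[1+ n ] _ = sym (trans (+-identityˡ _) (zeroʳ _))
  pascalˡ (+ suc m) -[1+ n ] _ = sym (trans (+-identityˡ _) (zeroʳ _))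
  pascalˡ (+ zero)  (+ zero) ()
  pascalˡ (+ zero)  (+ suc n) _ = begin
    qbinom-+ 0ℤ (+ suc n)            ≈⟨ qbinom-+-0ˡ (suc n) ⟩
    1#                               ≈⟨ qbinom-+-0ˡ n ⟨
    qbinom-+ 0ℤ (+ n)                ≈⟨ *-identityˡ _ ⟨
    1# * qbinom-+ 0ℤ (+ n)           ≈⟨ +-identityˡ _ ⟨
    0# + 1# * qbinom-+ 0ℤ (+ n)      ∎
  pascalˡ (+ suc m) (+ zero) _ = begin
    qbinom-+ (+ suc m) 0ℤ            ≈⟨ qbinom-+-0ʳ (suc m) ⟩
    1#                               ≈⟨ qbinom-+-0ʳ m ⟨
    qbinom-+ (+ m) 0ℤ                ≈⟨ +-identityʳ _ ⟨
    qbinom-+ (+ m) 0ℤ + 0#           ≈⟨ +-congˡ (zeroʳ _) ⟨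
    qbinom-+ (+ m) 0ℤ + q^ (+ suc m) * 0# ∎
  pascalˡ (+ suc m) (+ suc n) _ = sym (begin
    P (m ℕ.+ suc n) * (u m * u (suc n)) + a * (P (suc m ℕ.+ n) * (u (suc m) * u n))
      ≈⟨ +-cong (*-congˡ (*-congʳ (1/poch-q-suc m)))
                (*-congˡ (*-cong (reflexive (≡.cong P (≡.sym (ℕ.+-suc m n)))) (*-congˡ (1/poch-q-suc n)))) ⟩
    p * ((1# - a) * u (suc m) * u (suc n)) + a * (p * (u (suc m) * ((1# - b) * u (suc n))))
      ≈⟨ solve 6 (λ p a a- b- u v → p :* (a- :* u :* v) :+ a :* (p :* (u :* (b- :* v)))
                   := p :* (a- :+ a :* b-) :* (u :* v))
               refl p a (1# - a) (1# - b) (u (suc m)) (u (suc n)) ⟩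
    p * ((1# - a) + a * (1# - b)) * (u (suc m) * u (suc n))
      ≈⟨ *-congʳ (*-congˡ (trans (1-ab a b) (+-congˡ (-‿cong (sym (^-homo-* q (suc m) (suc n))))))) ⟩
    p * (1# - q ^ (suc m ℕ.+ suc n)) * (u (suc m) * u (suc n))
      ≈⟨ *-congʳ (poch-suc q (m ℕ.+ suc n)) ⟨
    P (suc m ℕ.+ suc n) * (u (suc m) * u (suc n)) ∎)
    where
    P = poch q
    u = 1/poch-q
    p = P (m ℕ.+ suc n)
    a = q ^ suc m
    b = q ^ suc n

  pascalʳ : ∀ {k} m n → m ℤ.+ n ≡ + suc k →
            qbinom-+ m n ≈ qbinom-+ m (n ℤ.- 1ℤ) + q^ n * qbinom-+ (m ℤ.- 1ℤ) n
  pascalʳ m n eq = begin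
    qbinom-+ m n ≈⟨ qbinom-+-comm m n ⟩
    qbinom-+ n m ≈⟨ pascalˡ n m (≡.trans (ℤ.+-comm n m) eq) ⟩
    qbinom-+ (n ℤ.- 1ℤ) m + q^ n * qbinom-+ n (m ℤ.- 1ℤ)
      ≈⟨ +-cong (qbinom-+-comm _ m) (*-congˡ (qbinom-+-comm n _)) ⟩
    qbinom-+ m (n ℤ.- 1ℤ) + q^ n * qbinom-+ (m ℤ.- 1ℤ) n ∎

  -- Powers of `q` as coefficients of binomials.

  -- Where an index is negative the binomial is 0, so coefficients need to agree only for
  -- nonnegative indices. This supplies the sign conditions that `q^-+` asks for.
  on-support : ∀ m n {α β} → (0ℤ ℤ.≤ m → 0ℤ ℤ.≤ n → α ≈ β) →
               α * qbinom-+ m n ≈ β * qbinom-+ m n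
  on-support (+ _)    (+ _)    α≈β = *-congʳ (α≈β (ℤ.+≤+ z≤n) (ℤ.+≤+ z≤n))
  on-support (+ _)    -[1+ _ ] _   = trans (zeroʳ _) (sym (zeroʳ _))
  on-support -[1+ _ ] _        _   = trans (zeroʳ _) (sym (zeroʳ _))

  -- Merges the power of `q` created by Pascal's rule with the quadratic power already present,
  -- leaving a factor `q ^ k` that does not depend on the summation index.
  absorbˡ : ∀ m n {e e′} k → 0ℤ ℤ.≤ e → 0ℤ ℤ.≤ e′ → e ℤ.+ m ≡ + k ℤ.+ e′ →
            q^ e * (q^ m * qbinom-+ m n) ≈ q ^ k * (q^ e′ * qbinom-+ m n)
  absorbˡ m n {e} {e′} k 0≤e 0≤e′ eq = begin
    q^ e * (q^ m * qbinom-+ m n)     ≈⟨ *-assoc _ _ _ ⟨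
    q^ e * q^ m * qbinom-+ m n       ≈⟨ on-support m n (λ 0≤m _ → begin
        q^ e * q^ m      ≈⟨ q^-+ 0≤e 0≤m ⟨
        q^ (e ℤ.+ m)     ≡⟨ ≡.cong q^_ eq ⟩
        q^ (+ k ℤ.+ e′)  ≈⟨ q^-+ (ℤ.+≤+ z≤n) 0≤e′ ⟩
        q ^ k * q^ e′    ∎) ⟩
    q ^ k * q^ e′ * qbinom-+ m n     ≈⟨ *-assoc _ _ _ ⟩
    q ^ k * (q^ e′ * qbinom-+ m n)   ∎

  absorbʳ : ∀ m n {e e′} k → 0ℤ ℤ.≤ e → 0ℤ ℤ.≤ e′ → e ℤ.+ n ≡ + k ℤ.+ e′ →
            q^ e * (q^ n * qbinom-+ m n) ≈ q ^ k * (q^ e′ * qbinom-+ m n)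
  absorbʳ m n k 0≤e 0≤e′ eq = begin
    _ ≈⟨ *-congˡ (*-congˡ (qbinom-+-comm m n)) ⟩
    _ ≈⟨ absorbˡ n m k 0≤e 0≤e′ eq ⟩
    _ ≈⟨ *-congˡ (*-congˡ (qbinom-+-comm n m)) ⟩
    _ ∎

  qbinom-+-predˡ : ∀ L m n → m ℤ.+ n ≡ + L ℤ.+ + L →
    qbinom-+ (m ℤ.- 1ℤ) n + q^ m * qbinom-+ m n ≈ qbinom-+ m n + q ^ L * q ^ L * qbinom-+ (m ℤ.- 1ℤ) n
  qbinom-+-predˡ zero (+ zero) (+ zero) _ = trans (+-identityˡ _) (trans (*-identityˡ _)
    (sym (trans (+-congˡ (zeroʳ _)) (+-identityʳ _))))
  qbinom-+-predˡ zero -[1+ m ] n _ = trans (+-identityˡ _) (trans (zeroʳ _)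
    (sym (trans (+-identityˡ _) (zeroʳ _))))
  qbinom-+-predˡ zero (+ zero) -[1+ n ] _ = trans (+-identityˡ _) (trans (zeroʳ _)
    (sym (trans (+-identityˡ _) (zeroʳ _))))
  qbinom-+-predˡ zero (+ suc m) -[1+ n ] _ = trans (+-identityˡ _) (trans (zeroʳ _)
    (sym (trans (+-identityˡ _) (zeroʳ _))))
  qbinom-+-predˡ L@(suc M) m n eq = begin
    D + q^ m * qbinom-+ m n ≈⟨ +-congˡ (*-congˡ (pascalʳ m n eq)) ⟩
    D + q^ m * (C + q^ n * D)
      ≈⟨ solve 4 (λ D a C b → D :+ a :* (C :+ b :* D) := (D :+ a :* C) :+ b :* a :* D) refl D (q^ m) C (q^ n) ⟩
    (D + q^ m * C) + q^ n * q^ m * D ≈⟨ +-cong (sym (pascalˡ m n eq)) (on-support (m ℤ.- 1ℤ) n powers) ⟩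
    qbinom-+ m n + q ^ L * q ^ L * D ∎
    where
    D = qbinom-+ (m ℤ.- 1ℤ) n
    C = qbinom-+ m (n ℤ.- 1ℤ)
    m-1+1 : ∀ m → m ℤ.- 1ℤ ℤ.+ 1ℤ ≡ m
    m-1+1 = ℤ-Solver.solve-∀
    powers : 0ℤ ℤ.≤ m ℤ.- 1ℤ → 0ℤ ℤ.≤ n → q^ n * q^ m ≈ q ^ L * q ^ L
    powers 0≤m-1 0≤n = begin
      q^ n * q^ m ≈⟨ *-comm _ _ ⟩
      q^ m * q^ n ≈⟨ q^-+ (≡.subst (0ℤ ℤ.≤_) (m-1+1 m) (ℤ.+-mono-≤ 0≤m-1 (ℤ.+≤+ {0} {1} z≤n))) 0≤n ⟨
      q^ (m ℤ.+ n) ≡⟨ ≡.cong q^_ eq ⟩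
      q^ (+ L ℤ.+ + L) ≈⟨ ^-homo-* q L L ⟩
      q ^ L * q ^ L ∎

  -- Finite sums.

  open Summation semiring using (sum-cong-≋; ∑-distrib-+; *-distribˡ-sum; sum-replicate-zero)

  ∑< : ℕ → (ℕ → Carrier) → Carrier
  ∑< n f = sum {n} λ i → f (toℕ i)

  ∑<-cong : ∀ n {f g : ℕ → Carrier} → (∀ k → f k ≈ g k) → ∑< n f ≈ ∑< n g
  ∑<-cong n f≈g = sum-cong-≋ {n} (λ i → f≈g (toℕ i))

  ∑<-+ : ∀ n (f g : ℕ → Carrier) → ∑< n (λ k → f k + g k) ≈ ∑< n f + ∑< n g
  ∑<-+ n f g = ∑-distrib-+ {n} (f ∘ toℕ) (g ∘ toℕ)

  ∑<-* : ∀ n α (f : ℕ → Carrier) → ∑< n (λ k → α * f k) ≈ α * ∑< n f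
  ∑<-* n α f = sym (*-distribˡ-sum {n} α (f ∘ toℕ))

  ∑<-snoc : ∀ n (f : ℕ → Carrier) → ∑< (suc n) f ≈ ∑< n f + f n
  ∑<-snoc zero    f = +-comm _ _
  ∑<-snoc (suc n) f = trans (+-congˡ (∑<-snoc n (f ∘ suc))) (sym (+-assoc _ _ _))

  -- The left-hand side

  module _ where
    private
      m+[n-m]≡n : ∀ n m → m ℤ.+ (n ℤ.- m) ≡ n
      m+[n-m]≡n = ℤ-Solver.solve-∀
      1+n-k-1≡n-k : ∀ n k → 1ℤ ℤ.+ n ℤ.- k ℤ.- 1ℤ ≡ n ℤ.- k
      1+n-k-1≡n-k = ℤ-Solver.solve-∀
      1+n-k≡n-[k-1] : ∀ n k → 1ℤ ℤ.+ n ℤ.- k ≡ n ℤ.- (k ℤ.- 1ℤ)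
      1+n-k≡n-[k-1] = ℤ-Solver.solve-∀

    qbinom-pascalʳ : ∀ L k → qbinom (+ suc L) k ≈
                     qbinom (+ L) k + q^ (+ suc L ℤ.- k) * qbinom (+ L) (k ℤ.- 1ℤ)
    qbinom-pascalʳ L k = trans (pascalʳ k (+ suc L ℤ.- k) (m+[n-m]≡n (+ suc L) k))
      (+-cong (qbinom-+-congʳ k (1+n-k-1≡n-k (+ L) k))
              (*-congˡ (qbinom-+-congʳ (k ℤ.- 1ℤ) (1+n-k≡n-[k-1] (+ L) k))))

    qbinom-pascalˡ : ∀ L k → qbinom (+ suc L) k ≈
                     q^ k * qbinom (+ L) k + qbinom (+ L) (k ℤ.- 1ℤ)
    qbinom-pascalˡ L k = trans (pascalˡ k (+ suc L ℤ.- k) (m+[n-m]≡n (+ suc L) k)) (trans (+-comm _ _)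
      (+-cong (*-congˡ (qbinom-+-congʳ k (1+n-k-1≡n-k (+ L) k)))
              (qbinom-+-congʳ (k ℤ.- 1ℤ) (1+n-k≡n-[k-1] (+ L) k))))

  rowSum : ℕ → (ℕ → Carrier) → Carrier
  rowSum L w = ∑≤ L λ k → w k * qbinom (+ L) (+ k)

  rowSum-linear : ∀ L α β {u v w : ℕ → Carrier} →
    (∀ k → 0ℤ ℤ.≤ + L ℤ.- + k → w k ≈ α * u k + β * v k) →
    rowSum L w ≈ α * rowSum L u + β * rowSum L v
  rowSum-linear L α β {u} {v} {w} w≈ = begin
    -- `∑<-cong` asks for every `k`, also beyond `L`; there the binomial vanishes.
    rowSum L w ≈⟨ ∑<-cong (suc L) (λ k → trans
        (on-support (+ k) (+ L ℤ.- + k) (λ _ → w≈ k))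
        (solve 5 (λ α β u v b → (α :* u :+ β :* v) :* b := α :* (u :* b) :+ β :* (v :* b))
           refl α β (u k) (v k) (qbinom (+ L) (+ k)))) ⟩
    ∑≤ L (λ k → α * (u k * qbinom (+ L) (+ k)) + β * (v k * qbinom (+ L) (+ k)))
      ≈⟨ ∑<-+ (suc L) (λ k → α * (u k * qbinom (+ L) (+ k))) (λ k → β * (v k * qbinom (+ L) (+ k))) ⟩
    ∑≤ L (λ k → α * (u k * qbinom (+ L) (+ k))) + ∑≤ L (λ k → β * (v k * qbinom (+ L) (+ k)))
      ≈⟨ +-cong (∑<-* (suc L) α (λ k → u k * qbinom (+ L) (+ k))) (∑<-* (suc L) β (λ k → v k * qbinom (+ L) (+ k))) ⟩
    α * rowSum L u + β * rowSum L v ∎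

  -- The longer range costs nothing: the `u`-part gains the term `k = L + 1`, which lies outside row
  -- `L`, and the `v`-part starts with lower entry -1, so dropping that zero term shifts the index.
  rowSum-pascal : ∀ L (u v w : ℕ → Carrier) →
    (∀ k → w k * qbinom (+ suc L) (+ k) ≈ u k * qbinom (+ L) (+ k) + v k * qbinom (+ L) (+ k ℤ.- 1ℤ)) →
    rowSum (suc L) w ≈ rowSum L u + rowSum L (v ∘ suc)
  rowSum-pascal L u v w split = begin
    rowSum (suc L) w ≈⟨ ∑<-cong (suc (suc L)) split ⟩
    ∑< (suc (suc L)) (λ k → U k + V k) ≈⟨ ∑<-+ (suc (suc L)) U V ⟩
    ∑< (suc (suc L)) U + ∑< (suc (suc L)) V ≈⟨ +-cong (∑<-snoc (suc L) U) (+-cong (zeroʳ _) refl) ⟩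
    (rowSum L u + U (suc L)) + (0# + rowSum L (v ∘ suc))
      ≈⟨ +-cong (trans (+-congˡ (trans (*-congˡ above-row) (zeroʳ _))) (+-identityʳ _)) (+-identityˡ _) ⟩
    rowSum L u + rowSum L (v ∘ suc) ∎
    where
    U V : ℕ → Carrier
    U k = u k * qbinom (+ L) (+ k)
    V k = v k * qbinom (+ L) (+ k ℤ.- 1ℤ)
    -1≡ : ∀ n → n ℤ.- (1ℤ ℤ.+ n) ≡ -[1+ 0 ]
    -1≡ = ℤ-Solver.solve-∀
    above-row : qbinom (+ L) (+ suc L) ≈ 0#
    above-row = qbinom-+-congʳ (+ suc L) (-1≡ (+ L))

  -- Since (k+1)(k+2) = 2(k+1) + k(k+1) and the first summand is even, the truncating division
  -- distributes over the sum.
  T-suc : ∀ k → T (+ suc k) ≡ suc k ℕ.+ T (+ k)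
  T-suc k = ≡.trans (≡.cong (_/ 2) (≡.trans (≡.cong ∣_∣ (expand (+ k))) (abs k)))
    (≡.trans (+-distrib-/-∣ˡ (k ℕ.* (k ℕ.+ 1)) (divides (suc k) ≡.refl))
      (≡.cong₂ ℕ._+_ (m*n/n≡m (suc k) 2) (≡.cong (λ z → ∣ z ∣ / 2) (ℤ.pos-* k (k ℕ.+ 1)))))
    where
    expand : ∀ k → (1ℤ ℤ.+ k) ℤ.* (1ℤ ℤ.+ k ℤ.+ + 1) ≡ (1ℤ ℤ.+ k) ℤ.* + 2 ℤ.+ k ℤ.* (k ℤ.+ + 1)
    expand = ℤ-Solver.solve-∀
    abs : ∀ k → ∣ (1ℤ ℤ.+ + k) ℤ.* + 2 ℤ.+ + k ℤ.* (+ k ℤ.+ + 1) ∣ ≡ suc k ℕ.* 2 ℕ.+ k ℕ.* (k ℕ.+ 1)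
    abs k = ≡.cong ∣_∣ (≡.cong₂ ℤ._+_ (≡.sym (ℤ.pos-* (suc k) 2)) (≡.sym (ℤ.pos-* k (k ℕ.+ 1))))

  ω ω₁ ω₂ : ℕ → Carrier
  ω  k = q ^ T (+ k) * poch (- q) k
  ω₁ k = ω k * q ^ k
  ω₂ k = ω₁ k * q ^ k

  ω-suc : ∀ k → ω (suc k) ≈ ω k * (q ^ suc k * (1# + q ^ suc k))
  ω-suc k = begin
    q ^ T (+ suc k) * poch (- q) (suc k)
      ≈⟨ *-cong (trans (reflexive (≡.cong (q ^_) (T-suc k))) (^-homo-* q (suc k) (T (+ k))))
                (trans (poch-suc (- q) k) (*-congˡ (+-congˡ -[-q*x]≈q*x))) ⟩
    q ^ suc k * q ^ T (+ k) * (poch (- q) k * (1# + q ^ suc k))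
      ≈⟨ solve 4 (λ a t p s → a :* t :* (p :* s) := t :* p :* (a :* s)) refl
           (q ^ suc k) (q ^ T (+ k)) (poch (- q) k) (1# + q ^ suc k) ⟩
    ω k * (q ^ suc k * (1# + q ^ suc k)) ∎
    where
    -[-q*x]≈q*x : - (- q * q ^ k) ≈ q * q ^ k
    -[-q*x]≈q*x = trans (-‿cong (sym (-‿distribˡ-* q (q ^ k)))) (-‿involutive _)

  -- `W` is auxiliary: it enters `V-suc` and `S-suc′` and is eliminated between them.
  S V W : ℕ → Carrier
  S L = rowSum L ω
  V L = rowSum L ω₁
  W L = rowSum L ω₂

  -- The power from Pascal's rule and the one from `ω-suc` combine into a factor free of `k`, which
  -- can leave the sum.
  q^k*q^[L-k] : ∀ L k → 0ℤ ℤ.≤ + L ℤ.- + k → q ^ suc k * q^ (+ suc L ℤ.- + suc k) ≈ q ^ suc L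
  q^k*q^[L-k] L k 0≤L-k = begin
    q ^ suc k * q^ (+ suc L ℤ.- + suc k) ≈⟨ q^-+ {+ suc k} (ℤ.+≤+ z≤n) (≡.subst (0ℤ ℤ.≤_) (shift (+ L) (+ k)) 0≤L-k) ⟨
    q^ (+ suc k ℤ.+ (+ suc L ℤ.- + suc k)) ≡⟨ ≡.cong q^_ (cancel (+ suc L) (+ suc k)) ⟩
    q ^ suc L ∎
    where
    shift : ∀ a b → a ℤ.- b ≡ (1ℤ ℤ.+ a) ℤ.- (1ℤ ℤ.+ b)
    shift = ℤ-Solver.solve-∀
    cancel : ∀ a b → b ℤ.+ (a ℤ.- b) ≡ a
    cancel = ℤ-Solver.solve-∀

  rowSum-pascalʳ : ∀ L w → rowSum (suc L) w ≈ rowSum L w + rowSum L (λ k → w (suc k) * q^ (+ suc L ℤ.- + suc k))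
  rowSum-pascalʳ L w = rowSum-pascal L w (λ k → w k * q^ (+ suc L ℤ.- + k)) w λ k → begin
    w k * qbinom (+ suc L) (+ k) ≈⟨ *-congˡ (qbinom-pascalʳ L (+ k)) ⟩
    w k * (qbinom (+ L) (+ k) + q^ (+ suc L ℤ.- + k) * qbinom (+ L) (+ k ℤ.- 1ℤ))
      ≈⟨ solve 4 (λ w a s b → w :* (a :+ s :* b) := w :* a :+ w :* s :* b) refl
           (w k) (qbinom (+ L) (+ k)) (q^ (+ suc L ℤ.- + k)) (qbinom (+ L) (+ k ℤ.- 1ℤ)) ⟩
    _ ∎

  rowSum-pascalˡ : ∀ L w → rowSum (suc L) w ≈ rowSum L (λ k → w k * q ^ k) + rowSum L (w ∘ suc)
  rowSum-pascalˡ L w = rowSum-pascal L (λ k → w k * q ^ k) w w λ k → begin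
    w k * qbinom (+ suc L) (+ k) ≈⟨ *-congˡ (qbinom-pascalˡ L (+ k)) ⟩
    w k * (q ^ k * qbinom (+ L) (+ k) + qbinom (+ L) (+ k ℤ.- 1ℤ))
      ≈⟨ solve 4 (λ w a s b → w :* (s :* a :+ b) := w :* s :* a :+ w :* b) refl
           (w k) (qbinom (+ L) (+ k)) (q ^ k) (qbinom (+ L) (+ k ℤ.- 1ℤ)) ⟩
    _ ∎

  S-suc : ∀ L → S (suc L) ≈ S L + (q ^ suc L * S L + q * q ^ suc L * V L)
  S-suc L = trans (rowSum-pascalʳ L ω) (+-congˡ (rowSum-linear L _ _ λ k 0≤L-k → begin
    ω (suc k) * r k ≈⟨ *-congʳ (ω-suc k) ⟩
    ω k * (q * q ^ k * (1# + q * q ^ k)) * r k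
      ≈⟨ solve 4 (λ w q a r → w :* (q :* a :* (con 1 :+ q :* a)) :* r := q :* a :* r :* (w :+ q :* (w :* a)))
           refl (ω k) q (q ^ k) (r k) ⟩
    q ^ suc k * r k * (ω k + q * ω₁ k) ≈⟨ *-congʳ (q^k*q^[L-k] L k 0≤L-k) ⟩
    q ^ suc L * (ω k + q * ω₁ k)
      ≈⟨ solve 4 (λ Q w q w₁ → Q :* (w :+ q :* w₁) := Q :* w :+ q :* Q :* w₁) refl (q ^ suc L) (ω k) q (ω₁ k) ⟩
    q ^ suc L * ω k + q * q ^ suc L * ω₁ k ∎))
    where
    r : ℕ → Carrier
    r k = q^ (+ suc L ℤ.- + suc k)

  V-suc : ∀ L → V (suc L) ≈ V L + (q * q ^ suc L * V L + q * q * q ^ suc L * W L)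
  V-suc L = trans (rowSum-pascalʳ L ω₁) (+-congˡ (rowSum-linear L _ _ λ k 0≤L-k → begin
    ω (suc k) * q ^ suc k * r k ≈⟨ *-congʳ (*-congʳ (ω-suc k)) ⟩
    ω k * (q * q ^ k * (1# + q * q ^ k)) * (q * q ^ k) * r k
      ≈⟨ solve 4 (λ w q a r → w :* (q :* a :* (con 1 :+ q :* a)) :* (q :* a) :* r
                    := q :* a :* r :* (q :* (w :* a) :+ q :* q :* (w :* a :* a)))
           refl (ω k) q (q ^ k) (r k) ⟩
    q ^ suc k * r k * (q * ω₁ k + q * q * ω₂ k) ≈⟨ *-congʳ (q^k*q^[L-k] L k 0≤L-k) ⟩
    q ^ suc L * (q * ω₁ k + q * q * ω₂ k)
      ≈⟨ solve 4 (λ Q q w₁ w₂ → Q :* (q :* w₁ :+ q :* q :* w₂) := q :* Q :* w₁ :+ q :* q :* Q :* w₂)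
           refl (q ^ suc L) q (ω₁ k) (ω₂ k) ⟩
    q * q ^ suc L * ω₁ k + q * q * q ^ suc L * ω₂ k ∎))
    where
    r : ℕ → Carrier
    r k = q^ (+ suc L ℤ.- + suc k)

  -- The other Pascal rule puts `q ^ k` on the unshifted term, turning `ω` into `ω₁`. This second
  -- formula for `S (suc L)` is what removes `W` from `V-suc`.
  S-suc′ : ∀ L → S (suc L) ≈ V L + (q * V L + q * q * W L)
  S-suc′ L = trans (rowSum-pascalˡ L ω) (+-congˡ (rowSum-linear L _ _ λ k _ → trans (ω-suc k)
    (solve 3 (λ w q a → w :* (q :* a :* (con 1 :+ q :* a)) := q :* (w :* a) :+ q :* q :* (w :* a :* a))
       refl (ω k) q (q ^ k))))

  S-zero : S 0 ≈ 1#
  S-zero = trans (+-identityʳ _) (trans (*-congˡ (qbinom-+-0ˡ 0)) (trans (*-identityʳ _) (*-identityˡ _)))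

  V-zero : V 0 ≈ 1#
  V-zero = trans (+-identityʳ _) (trans (*-congˡ (qbinom-+-0ˡ 0)) (trans (*-identityʳ _) (trans (*-identityʳ _) (*-identityˡ _))))

  -- The start of the recurrence, with no earlier row: since `V 0` and `S 0` are both 1, `S-suc`
  -- closes up in `S` alone.
  S-one : S 1 ≈ (1# + q + q ^ 1 * q ^ 1) * S 0
  S-one = begin
    S 1 ≈⟨ S-suc 0 ⟩
    S 0 + (q ^ 1 * S 0 + q * q ^ 1 * V 0) ≈⟨ +-congˡ (+-congˡ (*-congˡ (trans V-zero (sym S-zero)))) ⟩
    S 0 + (q ^ 1 * S 0 + q * q ^ 1 * S 0)
      ≈⟨ solve 2 (λ q s → s :+ (q :* con 1 :* s :+ q :* (q :* con 1) :* s) := (con 1 :+ q :+ q :* con 1 :* (q :* con 1)) :* s) refl q (S 0) ⟩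
    (1# + q + q ^ 1 * q ^ 1) * S 0 ∎

  S-recurrence : ∀ L → let p = q ^ suc L ; Q = q * p in
    -- The term `q * Q * (p * V L)` is added on both sides so that `V (suc L)` occurs together with
    -- `p * V L`, as in `V-relation`; no subtraction is then needed.
    S (suc (suc L)) + q * S L ≈ (1# + q + Q * Q) * S (suc L) + q * (p * p) * S L
  S-recurrence L = +-cancelʳ (q * Q * (p * V L)) _ _ (begin
    S (suc (suc L)) + q * S L + q * Q * (p * V L)
      ≈⟨ +-congʳ (+-congʳ (S-suc (suc L))) ⟩
    S₁ + (Q * S₁ + q * Q * V (suc L)) + q * S L + q * Q * (p * V L)
      ≈⟨ solve 7 (λ q Q p s s₁ v v₁ → s₁ :+ (Q :* s₁ :+ q :* Q :* v₁) :+ q :* s :+ q :* Q :* (p :* v)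
                   := s₁ :+ Q :* s₁ :+ q :* s :+ q :* Q :* (v₁ :+ p :* v)) refl q Q p (S L) S₁ (V L) (V (suc L)) ⟩
    S₁ + Q * S₁ + q * S L + q * Q * (V (suc L) + p * V L)
      ≈⟨ +-cong (+-congʳ (+-congˡ (*-congˡ (S-suc L)))) (*-congˡ V-relation) ⟩
    S₁ + Q * (S L + (p * S L + q * p * V L)) + q * S L + q * Q * (V L + p * S₁)
      ≈⟨ solve 5 (λ q p s s₁ v →
           s₁ :+ q :* p :* (s :+ (p :* s :+ q :* p :* v)) :+ q :* s :+ q :* (q :* p) :* (v :+ p :* s₁)
           := s₁ :+ q :* (s :+ (p :* s :+ q :* p :* v)) :+ q :* p :* (q :* p) :* s₁
              :+ q :* (p :* p) :* s :+ q :* (q :* p) :* (p :* v)) refl q p (S L) S₁ (V L) ⟩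
    S₁ + q * (S L + (p * S L + q * p * V L)) + Q * Q * S₁ + q * (p * p) * S L + q * Q * (p * V L)
      -- `S-suc L`, used above to expand, is now read backwards to produce `q * S₁`.
      ≈⟨ +-congʳ (+-congʳ (+-congʳ (+-congˡ (*-congˡ (S-suc L))))) ⟨
    S₁ + q * S₁ + Q * Q * S₁ + q * (p * p) * S L + q * Q * (p * V L)
      ≈⟨ +-congʳ (+-congʳ (solve 3 (λ q Q s → s :+ q :* s :+ Q :* Q :* s := (con 1 :+ q :+ Q :* Q) :* s) refl q Q S₁)) ⟩
    (1# + q + Q * Q) * S₁ + q * (p * p) * S L + q * Q * (p * V L) ∎)
    where
    p = q ^ suc L
    Q = q * p
    S₁ = S (suc L)
    V-relation : V (suc L) + p * V L ≈ V L + p * S₁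
    V-relation = begin
      V (suc L) + p * V L ≈⟨ +-congʳ (V-suc L) ⟩
      V L + (q * p * V L + q * q * p * W L) + p * V L
        ≈⟨ solve 4 (λ q p v w → v :+ (q :* p :* v :+ q :* q :* p :* w) :+ p :* v
                     := v :+ p :* (v :+ (q :* v :+ q :* q :* w))) refl q p (V L) (W L) ⟩
      V L + p * (V L + (q * V L + q * q * W L)) ≈⟨ +-congˡ (*-congˡ (S-suc′ L)) ⟨
      V L + p * S₁ ∎

  -- Bilateral sums over a window

  -- The range is -N ≤ j < N, with `i` paired to -1 - i. The reflection j ↦ -1 - j then merely swaps
  -- each pair, while j ↦ -j disturbs only the ends.
  window : ℕ → (ℤ → Carrier) → Carrier
  window N f = ∑< N λ i → f (+ i) + f -[1+ i ]

  window-cong : ∀ N {f g : ℤ → Carrier} → (∀ j → f j ≈ g j) → window N f ≈ window N g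
  window-cong N f≈g = ∑<-cong N (λ i → +-cong (f≈g (+ i)) (f≈g -[1+ i ]))

  window-+ : ∀ N (f g : ℤ → Carrier) → window N (λ j → f j + g j) ≈ window N f + window N g
  window-+ N f g = trans
    (∑<-cong N (λ i → solve 4 (λ a b c d → (a :+ b) :+ (c :+ d) := (a :+ c) :+ (b :+ d))
      refl (f (+ i)) (g (+ i)) (f -[1+ i ]) (g -[1+ i ])))
    (∑<-+ N (λ i → f (+ i) + f -[1+ i ]) (λ i → g (+ i) + g -[1+ i ]))

  window-* : ∀ N α (f : ℤ → Carrier) → window N (λ j → α * f j) ≈ α * window N f
  window-* N α f = trans (∑<-cong N (λ i → sym (distribˡ α (f (+ i)) (f -[1+ i ])))) (∑<-* N α (λ i → f (+ i) + f -[1+ i ]))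

  -1-_ : ℤ → ℤ
  -1- j = ℤ.- 1ℤ ℤ.- j

  -1-[+n] : ∀ n → -1- (+ n) ≡ -[1+ n ]
  -1-[+n] zero    = ≡.refl
  -1-[+n] (suc n) = ≡.refl

  window-reflect₋₁ : ∀ N (f : ℤ → Carrier) → window N (λ j → f (-1- j)) ≈ window N f
  window-reflect₋₁ N f = ∑<-cong N λ i →
    trans (+-congʳ (reflexive (≡.cong f (-1-[+n] i)))) (+-comm (f -[1+ i ]) (f (+ i)))

  window-reflect₀ : ∀ N (f : ℤ → Carrier) → f (+ N) ≈ 0# → f (ℤ.- + N) ≈ 0# →
                    window N (λ j → f (ℤ.- j)) ≈ window N f
  window-reflect₀ N f f[N]≈0 f[-N]≈0 = begin
    window N f⁻              ≈⟨ +-identityʳ _ ⟨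
    window N f⁻ + 0#         ≈⟨ +-congˡ f[-N]≈0 ⟨
    window N f⁻ + f⁻ (+ N)   ≈⟨ swap N ⟩
    window N f + f (+ N)     ≈⟨ +-congˡ f[N]≈0 ⟩
    window N f + 0#          ≈⟨ +-identityʳ _ ⟩
    window N f               ∎
    where
    f⁻ : ℤ → Carrier
    f⁻ j = f (ℤ.- j)
    exchange : ∀ w a b c → w + (a + b) + c ≈ w + a + (b + c)
    exchange = solve 4 (λ w a b c → w :+ (a :+ b) :+ c := w :+ a :+ (b :+ c)) refl
    -- Both sides add up `f` over -n ≤ j ≤ n.
    swap : ∀ n → window n f⁻ + f⁻ (+ n) ≈ window n f + f (+ n)
    swap zero    = refl
    swap (suc n) = begin
      window (suc n) f⁻ + f⁻ (+ suc n) ≈⟨ +-congʳ (∑<-snoc n (λ i → f⁻ (+ i) + f (+ suc i))) ⟩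
      window n f⁻ + (f⁻ (+ n) + f (+ suc n)) + f⁻ (+ suc n) ≈⟨ exchange _ _ _ _ ⟩
      window n f⁻ + f⁻ (+ n) + (f (+ suc n) + f⁻ (+ suc n)) ≈⟨ +-cong (swap n) (+-comm _ _) ⟩
      window n f + f (+ n) + (f⁻ (+ suc n) + f (+ suc n)) ≈⟨ exchange _ _ _ _ ⟨
      window n f + (f (+ n) + f⁻ (+ suc n)) + f (+ suc n) ≈⟨ +-congʳ (∑<-snoc n (λ i → f (+ i) + f -[1+ i ])) ⟨
      window (suc n) f + f (+ suc n) ∎

  window-vanishing : ∀ N (f : ℤ → Carrier) → (∀ j → 0 ℕ.< ∣ j ∣ → f j ≈ 0#) →
                     window (suc N) f ≈ f 0ℤ
  window-vanishing N f f≈0 = begin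
    f 0ℤ + f -[1+ 0 ] + ∑< N (λ i → f (+ suc i) + f -[1+ suc i ])
      ≈⟨ +-cong (trans (+-congˡ (f≈0 -[1+ 0 ] (s≤s z≤n))) (+-identityʳ _)) (trans
           (∑<-cong N (λ i → trans (+-cong (f≈0 (+ suc i) (s≤s z≤n)) (f≈0 -[1+ suc i ] (s≤s z≤n))) (+-identityʳ _)))
           (sum-replicate-zero N)) ⟩
    f 0ℤ + 0# ≈⟨ +-identityʳ _ ⟩
    f 0ℤ ∎

  -- The two bounds are independent so that induction can lower `m` while `n` stays fixed.
  ∑<-shifted : ∀ m n (f : ℤ → Carrier) →
    ∑< (suc (m ℕ.+ n)) (λ i → f (+ i ℤ.- + m)) ≈ ∑< m (λ i → f -[1+ i ]) + ∑< (suc n) (λ i → f (+ i))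
  ∑<-shifted zero    n f = trans (∑<-cong (suc n) λ i → reflexive (≡.cong f (ℤ.+-identityʳ (+ i))))
                                 (sym (+-identityˡ _))
  ∑<-shifted (suc m) n f = begin
    f -[1+ m ] + ∑< (suc (m ℕ.+ n)) (λ i → f (+ suc i ℤ.- + suc m))
      ≈⟨ +-congˡ (∑<-cong (suc (m ℕ.+ n)) λ i → reflexive (≡.cong f ([1+i]-[1+m]≡i-m (+ i) (+ m)))) ⟩
    f -[1+ m ] + ∑< (suc (m ℕ.+ n)) (λ i → f (+ i ℤ.- + m)) ≈⟨ +-congˡ (∑<-shifted m n f) ⟩
    f -[1+ m ] + (∑< m (λ i → f -[1+ i ]) + ∑< (suc n) (λ i → f (+ i)))
      ≈⟨ solve 3 (λ a b c → a :+ (b :+ c) := b :+ a :+ c) refl (f -[1+ m ]) _ _ ⟩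
    ∑< m (λ i → f -[1+ i ]) + f -[1+ m ] + ∑< (suc n) (λ i → f (+ i))
      ≈⟨ +-congʳ (∑<-snoc m (λ i → f -[1+ i ])) ⟨
    ∑< (suc m) (λ i → f -[1+ i ]) + ∑< (suc n) (λ i → f (+ i)) ∎
    where
    [1+i]-[1+m]≡i-m : ∀ i m → (1ℤ ℤ.+ i) ℤ.- (1ℤ ℤ.+ m) ≡ i ℤ.- m
    [1+i]-[1+m]≡i-m = ℤ-Solver.solve-∀

  -- The window reaches one index further to the left, hence the hypothesis at -N - 1.
  ∑±≈window : ∀ N (f : ℤ → Carrier) → f -[1+ N ] ≈ 0# → ∑± N f ≈ window (suc N) f
  ∑±≈window N f f≈0 = begin
    ∑± N f ≈⟨ ∑<-shifted N N f ⟩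
    ∑< N (λ i → f -[1+ i ]) + ∑< (suc N) (λ i → f (+ i))
      ≈⟨ +-comm _ _ ⟩
    ∑< (suc N) (λ i → f (+ i)) + ∑< N (λ i → f -[1+ i ])
      ≈⟨ +-congˡ (trans (+-congˡ f≈0) (+-identityʳ _)) ⟨
    ∑< (suc N) (λ i → f (+ i)) + (∑< N (λ i → f -[1+ i ]) + f -[1+ N ])
      ≈⟨ +-congˡ (∑<-snoc N (λ i → f -[1+ i ])) ⟨
    ∑< (suc N) (λ i → f (+ i)) + ∑< (suc N) (λ i → f -[1+ i ])
      ≈⟨ ∑<-+ (suc N) (λ i → f (+ i)) (λ i → f -[1+ i ]) ⟨
    window (suc N) f ∎

  -- The right-hand side

  sign : ℤ → Carrier
  sign j = (- 1#) ^ ∣ j ∣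

  -- The absolute values of j and -1 - j differ by one.
  sign-reflect₋₁ : ∀ j → sign j + sign (-1- j) ≈ 0#
  sign-reflect₋₁ (+ n) = trans (+-congˡ (trans (reflexive (≡.cong sign (-1-[+n] n))) (-1*x≈-x _))) (-‿inverseʳ _)
  sign-reflect₋₁ -[1+ n ] = trans (+-congʳ (-1*x≈-x _)) (-‿inverseˡ _)

  quad : ℕ → ℤ → ℤ
  quad β j = j ℤ.* (+ 6 ℤ.* j ℤ.+ + β)

  0≤* : ∀ {a b} → 0ℤ ℤ.≤ a → 0ℤ ℤ.≤ b → 0ℤ ℤ.≤ a ℤ.* b
  0≤* {+ a} {+ b} _ _ = ≡.subst (0ℤ ℤ.≤_) (ℤ.pos-* a b) (ℤ.+≤+ z≤n)

  -- Here γ = 6 - β witnesses β ≤ 6. For j = -(n+1) the value is (n+1)(6n + γ).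
  quad-nonneg : ∀ β γ → β ℕ.+ γ ≡ 6 → ∀ j → 0ℤ ℤ.≤ quad β j
  quad-nonneg β γ _ (+ n) = 0≤* {+ n} (ℤ.+≤+ z≤n) (ℤ.+-mono-≤ (0≤* {+ 6} {+ n} (ℤ.+≤+ z≤n) (ℤ.+≤+ z≤n)) (ℤ.+≤+ z≤n))
  quad-nonneg β γ β+γ≡6 -[1+ n ] = ≡.subst (0ℤ ℤ.≤_)
    (≡.trans (expand (+ n) (+ β) (+ γ)) (≡.cong (λ s → -[1+ n ] ℤ.* (+ s ℤ.* -[1+ n ] ℤ.+ + β)) β+γ≡6))
    (0≤* {+ suc n} (ℤ.+≤+ z≤n) (ℤ.+-mono-≤ (0≤* {+ (β ℕ.+ γ)} {+ n} (ℤ.+≤+ z≤n) (ℤ.+≤+ z≤n)) (ℤ.+≤+ {0} {γ} z≤n)))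
    where
    expand : ∀ n β γ → (1ℤ ℤ.+ n) ℤ.* ((β ℤ.+ γ) ℤ.* n ℤ.+ γ) ≡
             (ℤ.- (1ℤ ℤ.+ n)) ℤ.* ((β ℤ.+ γ) ℤ.* (ℤ.- (1ℤ ℤ.+ n)) ℤ.+ β)
    expand = ℤ-Solver.solve-∀

  term : ℕ → ℤ → ℤ → ℤ → Carrier
  term β m n j = sign j * (q^ quad β j * qbinom-+ m n)

  term-cong : ∀ β {m m′ n n′} → m ≡ m′ → n ≡ n′ → ∀ j → term β m n j ≈ term β m′ n′ j
  term-cong β {m} {m′} {n} {n′} m≡m′ n≡n′ j =
    *-congˡ (*-congˡ (qbinom-+-cong {m} {m′} {n} {n′} m≡m′ n≡n′))

  term-vanishesˡ : ∀ β m {k} n j → m ≡ -[1+ k ] → term β m n j ≈ 0#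
  term-vanishesˡ β _ n j ≡.refl = trans (*-congˡ (zeroʳ _)) (zeroʳ _)

  term-vanishesʳ : ∀ β m n {k} j → n ≡ -[1+ k ] → term β m n j ≈ 0#
  term-vanishesʳ β m n j n≡ = trans (*-congˡ (*-congˡ (qbinom-+-comm m n))) (term-vanishesˡ β n m j n≡)

  -- Termwise relations for a fixed `L`, and their sums.

  module Row (L : ℕ) where

    x y : ℤ → ℤ
    x j = + L ℤ.- + 3 ℤ.* j
    y j = + L ℤ.+ + 3 ℤ.* j

    e f g h : ℕ → ℤ → Carrier
    e β j = term β (x j)        (y j)         j
    f β j = term β (x j ℤ.- 1ℤ) (y j ℤ.+ 1ℤ)  j
    g β j = term β (x j ℤ.- 1ℤ) (y j ℤ.+ + 2) j
    h β j = term β (x j)        (y j ℤ.+ 1ℤ)  j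

    previous next : ℤ → Carrier
    previous j = term 2 (x j ℤ.- 1ℤ) (y j) j
    next     j = term 2 (x j ℤ.+ 1ℤ) (y j ℤ.+ + 2) j

    p Q : Carrier
    p = q ^ L
    Q = q * p

    x-negative : ∀ n → L ℕ.< n → ∃[ k ] x (+ n) ≡ -[1+ k ]
    x-negative n L<n with d , ≡.refl ← ℕ.m≤n⇒∃[o]m+o≡n L<n =
      -- With n = 1 + L + d, L - 3n = -(3 + 2L + 3d).
      2 ℕ.+ (L ℕ.+ L) ℕ.+ (d ℕ.+ d ℕ.+ d) , expand (+ L) (+ d)
      where
      expand : ∀ l d → l ℤ.- + 3 ℤ.* (1ℤ ℤ.+ l ℤ.+ d) ≡ ℤ.- (1ℤ ℤ.+ (+ 2 ℤ.+ (l ℤ.+ l) ℤ.+ (d ℤ.+ d ℤ.+ d)))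
      expand = ℤ-Solver.solve-∀

    -- The bound is -2 rather than -1 because `h` uses y + 1, which must still be negative.
    y-negative : ∀ n → L ℕ.< n → ∃[ k ] y (ℤ.- + n) ≡ -[1+ suc k ]
    y-negative n L<n with d , ≡.refl ← ℕ.m≤n⇒∃[o]m+o≡n L<n =
      1 ℕ.+ (L ℕ.+ L) ℕ.+ (d ℕ.+ d ℕ.+ d) , expand (+ L) (+ d)
      where
      expand : ∀ l d → l ℤ.+ + 3 ℤ.* (ℤ.- (1ℤ ℤ.+ l ℤ.+ d)) ≡ ℤ.- (+ 2 ℤ.+ (1ℤ ℤ.+ (l ℤ.+ l) ℤ.+ (d ℤ.+ d ℤ.+ d)))
      expand = ℤ-Solver.solve-∀

    h-vanishes : ∀ β j → L ℕ.< ∣ j ∣ → h β j ≈ 0#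
    h-vanishes β (+ n)    L<∣j∣ = term-vanishesˡ β (x (+ n)) (y (+ n) ℤ.+ 1ℤ) (+ n) (proj₂ (x-negative n L<∣j∣))
    h-vanishes β -[1+ n ] L<∣j∣ = term-vanishesʳ β (x -[1+ n ]) (y -[1+ n ] ℤ.+ 1ℤ) -[1+ n ]
      (≡.cong (ℤ._+ 1ℤ) (proj₂ (y-negative (suc n) L<∣j∣)))

    e-vanishes : ∀ β j → L ℕ.< ∣ j ∣ → e β j ≈ 0#
    e-vanishes β (+ n)    L<∣j∣ = term-vanishesˡ β (x (+ n)) (y (+ n)) (+ n) (proj₂ (x-negative n L<∣j∣))
    e-vanishes β -[1+ n ] L<∣j∣ = term-vanishesʳ β (x -[1+ n ]) (y -[1+ n ]) -[1+ n ]
      (proj₂ (y-negative (suc n) L<∣j∣))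

    private
      x+y : ∀ l j → (l ℤ.- + 3 ℤ.* j) ℤ.+ (l ℤ.+ + 3 ℤ.* j) ≡ l ℤ.+ l
      x+y = ℤ-Solver.solve-∀
      m+1-1 : ∀ m → m ℤ.+ 1ℤ ℤ.- 1ℤ ≡ m
      m+1-1 = ℤ-Solver.solve-∀
      m+2-1 : ∀ m → m ℤ.+ + 2 ℤ.- 1ℤ ≡ m ℤ.+ 1ℤ
      m+2-1 = ℤ-Solver.solve-∀

    -- Pascal's rule produces the exponent y + 1 = L + 1 + 3j: the part 3j raises β by 3 and the
    -- rest becomes `Q`.
    h-split : ∀ {β β′} γ γ′ → β ℕ.+ γ ≡ 6 → β′ ℕ.+ γ′ ≡ 6 → β′ ≡ 3 ℕ.+ β →
              ∀ j → h β j ≈ e β j + Q * f β′ j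
    h-split {β} {β′} γ γ′ β+γ β′+γ′ ≡.refl j = begin
      s * (P * qbinom-+ X (Y ℤ.+ 1ℤ)) ≈⟨ *-congˡ (*-congˡ (pascalʳ {L ℕ.+ L} X (Y ℤ.+ 1ℤ) (total (+ L) j))) ⟩
      s * (P * (qbinom-+ X (Y ℤ.+ 1ℤ ℤ.- 1ℤ) + q^ (Y ℤ.+ 1ℤ) * F))
        ≈⟨ *-congˡ (*-congˡ (+-congʳ (qbinom-+-congʳ X (m+1-1 Y)))) ⟩
      s * (P * (qbinom-+ X Y + q^ (Y ℤ.+ 1ℤ) * F))
        ≈⟨ solve 4 (λ s P a b → s :* (P :* (a :+ b)) := s :* (P :* a) :+ s :* (P :* b)) refl s P (qbinom-+ X Y) (q^ (Y ℤ.+ 1ℤ) * F) ⟩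
      s * (P * qbinom-+ X Y) + s * (P * (q^ (Y ℤ.+ 1ℤ) * F))
        ≈⟨ +-congˡ (*-congˡ (absorbʳ (X ℤ.- 1ℤ) (Y ℤ.+ 1ℤ) (suc L)
             (quad-nonneg β γ β+γ j) (quad-nonneg β′ γ′ β′+γ′ j) (exponent (+ L) j (+ β)))) ⟩
      s * (P * qbinom-+ X Y) + s * (Q * (q^ quad β′ j * F))
        ≈⟨ solve 4 (λ a s Q b → a :+ s :* (Q :* b) := a :+ Q :* (s :* b)) refl _ s Q (q^ quad β′ j * F) ⟩
      e β j + Q * f β′ j ∎
      where
      s = sign j
      P = q^ quad β j
      X = x j
      Y = y j
      F = qbinom-+ (X ℤ.- 1ℤ) (Y ℤ.+ 1ℤ)
      total : ∀ l j → (l ℤ.- + 3 ℤ.* j) ℤ.+ (l ℤ.+ + 3 ℤ.* j ℤ.+ 1ℤ) ≡ 1ℤ ℤ.+ (l ℤ.+ l)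
      total = ℤ-Solver.solve-∀
      exponent : ∀ l j β → j ℤ.* (+ 6 ℤ.* j ℤ.+ β) ℤ.+ (l ℤ.+ + 3 ℤ.* j ℤ.+ 1ℤ) ≡
                 1ℤ ℤ.+ l ℤ.+ j ℤ.* (+ 6 ℤ.* j ℤ.+ (+ 3 ℤ.+ β))
      exponent = ℤ-Solver.solve-∀

    -- Pascal's rule turns `g 5 j` into `f 5 j` plus a remainder. By the symmetry of binomials that
    -- remainder has the power and binomial of `p * f 4 (-1- j)` but the opposite sign, so the two
    -- cancel.
    g-split : ∀ j → g 5 j + p * f 4 (-1- j) ≈ f 5 j
    g-split j = begin
      s * (P * qbinom-+ (X ℤ.- 1ℤ) (Y ℤ.+ + 2)) + p * f 4 (-1- j)
        ≈⟨ +-congʳ (*-congˡ (*-congˡ (pascalʳ {L ℕ.+ L} (X ℤ.- 1ℤ) (Y ℤ.+ + 2) (total (+ L) j)))) ⟩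
      s * (P * (qbinom-+ (X ℤ.- 1ℤ) (Y ℤ.+ + 2 ℤ.- 1ℤ) + q^ (Y ℤ.+ + 2) * G)) + p * f 4 (-1- j)
        ≈⟨ +-congʳ (*-congˡ (*-congˡ (+-congʳ (qbinom-+-congʳ (X ℤ.- 1ℤ) (m+2-1 Y))))) ⟩
      s * (P * (F + q^ (Y ℤ.+ + 2) * G)) + p * f 4 (-1- j)
        ≈⟨ +-congʳ (*-congˡ (trans (distribˡ P _ _) (+-congˡ (absorbʳ (X ℤ.- 1ℤ ℤ.- 1ℤ) (Y ℤ.+ + 2) L
             (quad-nonneg 5 1 ≡.refl j) (quad-nonneg 4 2 ≡.refl (-1- j)) (exponent (+ L) j))))) ⟩
      s * (P * F + p * (P′ * G)) + p * (s′ * (P′ * qbinom-+ (x (-1- j) ℤ.- 1ℤ) (y (-1- j) ℤ.+ 1ℤ)))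
        ≈⟨ +-congˡ (*-congˡ (*-congˡ (*-congˡ (trans
             (qbinom-+-cong {x (-1- j) ℤ.- 1ℤ} {Y ℤ.+ + 2} (x-reflect (+ L) j) (y-reflect (+ L) j))
             (qbinom-+-comm (Y ℤ.+ + 2) (X ℤ.- 1ℤ ℤ.- 1ℤ)))))) ⟩
      s * (P * F + p * (P′ * G)) + p * (s′ * (P′ * G))
        ≈⟨ solve 5 (λ s s′ a p b → s :* (a :+ p :* b) :+ p :* (s′ :* b) := s :* a :+ (s :+ s′) :* (p :* b))
             refl s s′ (P * F) p (P′ * G) ⟩
      s * (P * F) + (s + s′) * (p * (P′ * G)) ≈⟨ +-congˡ (trans (*-congʳ (sign-reflect₋₁ j)) (zeroˡ _)) ⟩
      f 5 j + 0# ≈⟨ +-identityʳ _ ⟩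
      f 5 j ∎
      where
      s = sign j
      s′ = sign (-1- j)
      P = q^ quad 5 j
      P′ = q^ quad 4 (-1- j)
      X = x j
      Y = y j
      F = qbinom-+ (X ℤ.- 1ℤ) (Y ℤ.+ 1ℤ)
      G = qbinom-+ (X ℤ.- 1ℤ ℤ.- 1ℤ) (Y ℤ.+ + 2)
      total : ∀ l j → (l ℤ.- + 3 ℤ.* j ℤ.- 1ℤ) ℤ.+ (l ℤ.+ + 3 ℤ.* j ℤ.+ + 2) ≡ 1ℤ ℤ.+ (l ℤ.+ l)
      total = ℤ-Solver.solve-∀
      exponent : ∀ l j → j ℤ.* (+ 6 ℤ.* j ℤ.+ + 5) ℤ.+ (l ℤ.+ + 3 ℤ.* j ℤ.+ + 2) ≡
                 l ℤ.+ (ℤ.- 1ℤ ℤ.- j) ℤ.* (+ 6 ℤ.* (ℤ.- 1ℤ ℤ.- j) ℤ.+ + 4)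
      exponent = ℤ-Solver.solve-∀
      x-reflect : ∀ l j → l ℤ.- + 3 ℤ.* (ℤ.- 1ℤ ℤ.- j) ℤ.- 1ℤ ≡ l ℤ.+ + 3 ℤ.* j ℤ.+ + 2
      x-reflect = ℤ-Solver.solve-∀
      y-reflect : ∀ l j → l ℤ.+ + 3 ℤ.* (ℤ.- 1ℤ ℤ.- j) ℤ.+ 1ℤ ≡ l ℤ.- + 3 ℤ.* j ℤ.- 1ℤ ℤ.- 1ℤ
      y-reflect = ℤ-Solver.solve-∀

    -- The sign is even in `j` and the binomial symmetric. The exponent stays as `quad 1` at -j,
    -- since 6j² + 2j - 3j is exactly that and `absorbˡ` delivers it in this form.
    reflect₀ : ∀ {m n m′ n′} j → m ≡ n′ → n ≡ m′ →
               term 1 m n (ℤ.- j) ≈ sign j * (q^ quad 1 (ℤ.- j) * qbinom-+ m′ n′)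
    reflect₀ {m} {n} j ≡.refl ≡.refl =
      *-cong (reflexive (≡.cong ((- 1#) ^_) (ℤ.∣-i∣≡∣i∣ j))) (*-congˡ (qbinom-+-comm m n))

    private
      x-reflect₀ : ∀ l j → l ℤ.- + 3 ℤ.* (ℤ.- j) ≡ l ℤ.+ + 3 ℤ.* j
      x-reflect₀ = ℤ-Solver.solve-∀
      y-reflect₀ : ∀ l j → l ℤ.+ + 3 ℤ.* (ℤ.- j) ≡ l ℤ.- + 3 ℤ.* j
      y-reflect₀ = ℤ-Solver.solve-∀

    -- Two rounds of Pascal's rule give four binomials. Two of them are `H`, with coefficients 1
    -- and, on its support, the power 2L + 2 of `q`; `E` is the reflected binomial of `h 1`, and `G`
    -- belongs to `g 5`.
    next-split : ∀ j → next j ≈ h 2 j + (Q * Q * h 2 j + (Q * h 1 (ℤ.- j) + q * Q * g 5 j))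
    next-split j = begin
      s * (P * qbinom-+ (X ℤ.+ 1ℤ) (Y ℤ.+ + 2)) ≈⟨ *-congˡ (*-congˡ split) ⟩
      s * (P * ((H + q^ (X ℤ.+ 1ℤ) * E) + (q^ (Y ℤ.+ + 2) * G + Q * Q * H)))
        ≈⟨ solve 6 (λ s P H E G QQ → s :* (P :* ((H :+ E) :+ (G :+ QQ :* H)))
             := s :* (P :* H) :+ (QQ :* (s :* (P :* H)) :+ (s :* (P :* E) :+ s :* (P :* G))))
             refl s P H (q^ (X ℤ.+ 1ℤ) * E) (q^ (Y ℤ.+ + 2) * G) (Q * Q) ⟩
      s * (P * H) + (Q * Q * (s * (P * H)) + (s * (P * (q^ (X ℤ.+ 1ℤ) * E)) + s * (P * (q^ (Y ℤ.+ + 2) * G))))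
        ≈⟨ +-congˡ (+-congˡ (+-cong
             (*-congˡ (absorbˡ (X ℤ.+ 1ℤ) Y (suc L) P-nonneg (quad-nonneg 1 5 ≡.refl (ℤ.- j)) (exponent₁ (+ L) j)))
             (*-congˡ (absorbʳ (X ℤ.- 1ℤ) (Y ℤ.+ + 2) (suc (suc L)) P-nonneg (quad-nonneg 5 1 ≡.refl j) (exponent₂ (+ L) j))))) ⟩
      s * (P * H) + (Q * Q * (s * (P * H)) + (s * (Q * (q^ quad 1 (ℤ.- j) * E)) + s * (q * Q * (q^ quad 5 j * G))))
        ≈⟨ +-congˡ (+-congˡ (solve 5 (λ s Q a qQ b → s :* (Q :* a) :+ s :* (qQ :* b) := Q :* (s :* a) :+ qQ :* (s :* b))
             refl s Q (q^ quad 1 (ℤ.- j) * E) (q * Q) (q^ quad 5 j * G))) ⟩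
      h 2 j + (Q * Q * h 2 j + (Q * (s * (q^ quad 1 (ℤ.- j) * E)) + q * Q * g 5 j))
        ≈⟨ +-congˡ (+-congˡ (+-congʳ (*-congˡ (reflect₀ {x (ℤ.- j)} {y (ℤ.- j) ℤ.+ 1ℤ} {X ℤ.+ 1ℤ} {Y} j
             (x-reflect₀ (+ L) j) (≡.cong (ℤ._+ 1ℤ) (y-reflect₀ (+ L) j)))))) ⟨
      h 2 j + (Q * Q * h 2 j + (Q * h 1 (ℤ.- j) + q * Q * g 5 j)) ∎
      where
      s = sign j
      P = q^ quad 2 j
      P-nonneg = quad-nonneg 2 4 ≡.refl j
      X = x j
      Y = y j
      H = qbinom-+ X (Y ℤ.+ 1ℤ)
      E = qbinom-+ (X ℤ.+ 1ℤ) Y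
      G = qbinom-+ (X ℤ.- 1ℤ) (Y ℤ.+ + 2)
      total₁ : ∀ l j → (l ℤ.- + 3 ℤ.* j ℤ.+ 1ℤ) ℤ.+ (l ℤ.+ + 3 ℤ.* j ℤ.+ + 2) ≡ + 3 ℤ.+ (l ℤ.+ l)
      total₁ = ℤ-Solver.solve-∀
      total₂ : ∀ l j → (l ℤ.- + 3 ℤ.* j ℤ.+ 1ℤ) ℤ.+ (l ℤ.+ + 3 ℤ.* j ℤ.+ 1ℤ) ≡ + 2 ℤ.+ (l ℤ.+ l)
      total₂ = ℤ-Solver.solve-∀
      total₃ : ∀ l j → (l ℤ.- + 3 ℤ.* j) ℤ.+ (l ℤ.+ + 3 ℤ.* j ℤ.+ + 2) ≡ + 2 ℤ.+ (l ℤ.+ l)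
      total₃ = ℤ-Solver.solve-∀
      total₄ : ∀ l j → (l ℤ.+ + 3 ℤ.* j ℤ.+ + 2) ℤ.+ (l ℤ.- + 3 ℤ.* j) ≡ (1ℤ ℤ.+ l) ℤ.+ (1ℤ ℤ.+ l)
      total₄ = ℤ-Solver.solve-∀
      exponent₁ : ∀ l j → j ℤ.* (+ 6 ℤ.* j ℤ.+ + 2) ℤ.+ (l ℤ.- + 3 ℤ.* j ℤ.+ 1ℤ) ≡
                  1ℤ ℤ.+ l ℤ.+ (ℤ.- j) ℤ.* (+ 6 ℤ.* (ℤ.- j) ℤ.+ 1ℤ)
      exponent₁ = ℤ-Solver.solve-∀
      exponent₂ : ∀ l j → j ℤ.* (+ 6 ℤ.* j ℤ.+ + 2) ℤ.+ (l ℤ.+ + 3 ℤ.* j ℤ.+ + 2) ≡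
                  + 2 ℤ.+ l ℤ.+ j ℤ.* (+ 6 ℤ.* j ℤ.+ + 5)
      exponent₂ = ℤ-Solver.solve-∀
      n+1+1 : ∀ n → n ℤ.+ 1ℤ ℤ.+ 1ℤ ≡ n ℤ.+ + 2
      n+1+1 = ℤ-Solver.solve-∀
      powers : 0ℤ ℤ.≤ X → 0ℤ ℤ.≤ Y ℤ.+ 1ℤ → q^ (Y ℤ.+ + 2) * q^ X ≈ Q * Q
      powers 0≤X 0≤Y+1 = begin
        q^ (Y ℤ.+ + 2) * q^ X ≈⟨ q^-+ (≡.subst (0ℤ ℤ.≤_) (n+1+1 Y) (ℤ.+-mono-≤ 0≤Y+1 (ℤ.+≤+ {0} {1} z≤n))) 0≤X ⟨
        q^ (Y ℤ.+ + 2 ℤ.+ X) ≡⟨ ≡.cong q^_ (total₄ (+ L) j) ⟩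
        q^ (+ suc L ℤ.+ + suc L) ≈⟨ ^-homo-* q (suc L) (suc L) ⟩
        Q * Q ∎
      split : qbinom-+ (X ℤ.+ 1ℤ) (Y ℤ.+ + 2) ≈ (H + q^ (X ℤ.+ 1ℤ) * E) + (q^ (Y ℤ.+ + 2) * G + Q * Q * H)
      split = begin
        qbinom-+ (X ℤ.+ 1ℤ) (Y ℤ.+ + 2)
          ≈⟨ pascalʳ {2 ℕ.+ (L ℕ.+ L)} (X ℤ.+ 1ℤ) (Y ℤ.+ + 2) (total₁ (+ L) j) ⟩
        qbinom-+ (X ℤ.+ 1ℤ) (Y ℤ.+ + 2 ℤ.- 1ℤ) + q^ (Y ℤ.+ + 2) * qbinom-+ (X ℤ.+ 1ℤ ℤ.- 1ℤ) (Y ℤ.+ + 2)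
          ≈⟨ +-cong (qbinom-+-congʳ (X ℤ.+ 1ℤ) (m+2-1 Y))
                    (*-congˡ (qbinom-+-congˡ (Y ℤ.+ + 2) (m+1-1 X))) ⟩
        qbinom-+ (X ℤ.+ 1ℤ) (Y ℤ.+ 1ℤ) + q^ (Y ℤ.+ + 2) * qbinom-+ X (Y ℤ.+ + 2)
          ≈⟨ +-cong (pascalˡ {1 ℕ.+ (L ℕ.+ L)} (X ℤ.+ 1ℤ) (Y ℤ.+ 1ℤ) (total₂ (+ L) j))
                    (*-congˡ (pascalˡ {1 ℕ.+ (L ℕ.+ L)} X (Y ℤ.+ + 2) (total₃ (+ L) j))) ⟩
        (qbinom-+ (X ℤ.+ 1ℤ ℤ.- 1ℤ) (Y ℤ.+ 1ℤ) + q^ (X ℤ.+ 1ℤ) * qbinom-+ (X ℤ.+ 1ℤ) (Y ℤ.+ 1ℤ ℤ.- 1ℤ))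
          + q^ (Y ℤ.+ + 2) * (G + q^ X * qbinom-+ X (Y ℤ.+ + 2 ℤ.- 1ℤ))
          ≈⟨ +-cong (+-cong (qbinom-+-congˡ (Y ℤ.+ 1ℤ) (m+1-1 X)) (*-congˡ (qbinom-+-congʳ (X ℤ.+ 1ℤ) (m+1-1 Y))))
                    (*-congˡ (+-congˡ (*-congˡ (qbinom-+-congʳ X (m+2-1 Y))))) ⟩
        (H + q^ (X ℤ.+ 1ℤ) * E) + q^ (Y ℤ.+ + 2) * (G + q^ X * H)
          ≈⟨ +-congˡ (solve 4 (λ r G t H → r :* (G :+ t :* H) := r :* G :+ r :* t :* H) refl (q^ (Y ℤ.+ + 2)) G (q^ X) H) ⟩
        (H + q^ (X ℤ.+ 1ℤ) * E) + (q^ (Y ℤ.+ + 2) * G + q^ (Y ℤ.+ + 2) * q^ X * H)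
          ≈⟨ +-congˡ (+-congˡ (on-support X (Y ℤ.+ 1ℤ) powers)) ⟩
        (H + q^ (X ℤ.+ 1ℤ) * E) + (q^ (Y ℤ.+ + 2) * G + Q * Q * H) ∎

    -- This is `qbinom-+-predˡ` times the sign and the quadratic power; multiplying by `q^ X`
    -- changes the exponent to `quad 1` at -j and leaves `p`.
    previous-relation : ∀ j → previous j + p * e 1 (ℤ.- j) ≈ e 2 j + p * p * previous j
    previous-relation j = begin
      s * (P * D) + p * e 1 (ℤ.- j)
        ≈⟨ +-congˡ (*-congˡ (reflect₀ {x (ℤ.- j)} {y (ℤ.- j)} {X} {Y} j (x-reflect₀ (+ L) j) (y-reflect₀ (+ L) j))) ⟩
      s * (P * D) + p * (s * (q^ quad 1 (ℤ.- j) * B))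
        ≈⟨ solve 4 (λ a p s b → a :+ p :* (s :* b) := a :+ s :* (p :* b)) refl _ p s (q^ quad 1 (ℤ.- j) * B) ⟩
      s * (P * D) + s * (p * (q^ quad 1 (ℤ.- j) * B))
        ≈⟨ +-congˡ (*-congˡ (absorbˡ X Y L (quad-nonneg 2 4 ≡.refl j) (quad-nonneg 1 5 ≡.refl (ℤ.- j)) (exponent (+ L) j))) ⟨
      s * (P * D) + s * (P * (q^ X * B))
        ≈⟨ solve 4 (λ s P a b → s :* (P :* a) :+ s :* (P :* b) := s :* (P :* (a :+ b))) refl s P D (q^ X * B) ⟩
      s * (P * (D + q^ X * B)) ≈⟨ *-congˡ (*-congˡ (qbinom-+-predˡ L X Y (x+y (+ L) j))) ⟩
      s * (P * (B + p * p * D))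
        ≈⟨ solve 5 (λ s P a p b → s :* (P :* (a :+ p :* b)) := s :* (P :* a) :+ p :* (s :* (P :* b))) refl s P B (p * p) D ⟩
      s * (P * B) + p * p * (s * (P * D)) ∎
      where
      s = sign j
      P = q^ quad 2 j
      X = x j
      Y = y j
      D = qbinom-+ (X ℤ.- 1ℤ) Y
      B = qbinom-+ X Y
      exponent : ∀ l j → j ℤ.* (+ 6 ℤ.* j ℤ.+ + 2) ℤ.+ (l ℤ.- + 3 ℤ.* j) ≡
                 l ℤ.+ (ℤ.- j) ℤ.* (+ 6 ℤ.* (ℤ.- j) ℤ.+ 1ℤ)
      exponent = ℤ-Solver.solve-∀

    -- The bound `L < N` makes `e 1` and `h 1` vanish at both ends, so that j ↦ -j preserves their
    -- window sums.
    window-recurrence : ∀ N → L ℕ.< N →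
      window N next + q * window N previous ≈ (1# + q + Q * Q) * window N (h 2) + q * (p * p) * window N previous
    window-recurrence N L<N = begin
      Σ next + q * Σ previous ≈⟨ +-congʳ Σnext ⟩
      Σ (h 2) + (Q * Q * Σ (h 2) + (Q * Σ (h 1) + q * Q * Σ (g 5))) + q * Σ previous
        ≈⟨ +-congʳ (+-congˡ (+-congˡ (+-congʳ (*-congˡ (Σh (h-split 5 2 ≡.refl ≡.refl ≡.refl)))))) ⟩
      Σ (h 2) + (Q * Q * Σ (h 2) + (Q * (Σ (e 1) + Q * Σ (f 4)) + q * Q * Σ (g 5))) + q * Σ previous
        ≈⟨ solve 7 (λ q p h e f g t →
             h :+ ((q :* p) :* (q :* p) :* h :+ ((q :* p) :* (e :+ (q :* p) :* f) :+ q :* (q :* p) :* g)) :+ q :* t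
             := h :+ (q :* p) :* (q :* p) :* h :+ q :* (t :+ p :* e) :+ q :* (q :* p) :* (g :+ p :* f))
             refl q p (Σ (h 2)) (Σ (e 1)) (Σ (f 4)) (Σ (g 5)) (Σ previous) ⟩
      Σ (h 2) + Q * Q * Σ (h 2) + q * (Σ previous + p * Σ (e 1)) + q * Q * (Σ (g 5) + p * Σ (f 4))
        ≈⟨ +-cong (+-congˡ (*-congˡ Σprevious)) (*-congˡ Σg) ⟩
      Σ (h 2) + Q * Q * Σ (h 2) + q * (Σ (e 2) + p * p * Σ previous) + q * Q * Σ (f 5)
        ≈⟨ solve 6 (λ q p h e f t →
             h :+ (q :* p) :* (q :* p) :* h :+ q :* (e :+ p :* p :* t) :+ q :* (q :* p) :* f
             := h :+ (q :* p) :* (q :* p) :* h :+ q :* (e :+ (q :* p) :* f) :+ q :* (p :* p) :* t)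
             refl q p (Σ (h 2)) (Σ (e 2)) (Σ (f 5)) (Σ previous) ⟩
      Σ (h 2) + Q * Q * Σ (h 2) + q * (Σ (e 2) + Q * Σ (f 5)) + q * (p * p) * Σ previous
        -- `h-split` served above to expand `h 1`; here, at β = 2, it is read backwards to
        -- reassemble `h 2`.
        ≈⟨ +-congʳ (+-congˡ (*-congˡ (Σh (h-split 4 1 ≡.refl ≡.refl ≡.refl)))) ⟨
      Σ (h 2) + Q * Q * Σ (h 2) + q * Σ (h 2) + q * (p * p) * Σ previous
        ≈⟨ +-congʳ (solve 3 (λ q Q h → h :+ Q :* Q :* h :+ q :* h := (con 1 :+ q :+ Q :* Q) :* h) refl q Q (Σ (h 2))) ⟩
      (1# + q + Q * Q) * Σ (h 2) + q * (p * p) * Σ previous ∎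
      where
      Σ : (ℤ → Carrier) → Carrier
      Σ = window N

      Σ-linear : ∀ (u : ℤ → Carrier) α v → Σ (λ j → u j + α * v j) ≈ Σ u + α * Σ v
      Σ-linear u α v = trans (window-+ N u (λ j → α * v j)) (+-congˡ (window-* N α v))

      L<∣-N∣ : L ℕ.< ∣ ℤ.- + N ∣
      L<∣-N∣ = ≡.subst (L ℕ.<_) (≡.sym (ℤ.∣-i∣≡∣i∣ (+ N))) L<N

      Σh : ∀ {β β′} → (∀ j → h β j ≈ e β j + Q * f β′ j) → Σ (h β) ≈ Σ (e β) + Q * Σ (f β′)
      Σh {β} {β′} split = trans (window-cong N split) (Σ-linear (e β) Q (f β′))

      Σg : Σ (g 5) + p * Σ (f 4) ≈ Σ (f 5)
      Σg = begin
        Σ (g 5) + p * Σ (f 4) ≈⟨ +-congˡ (*-congˡ (window-reflect₋₁ N (f 4))) ⟨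
        Σ (g 5) + p * Σ (λ j → f 4 (-1- j)) ≈⟨ Σ-linear (g 5) p (λ j → f 4 (-1- j)) ⟨
        Σ (λ j → g 5 j + p * f 4 (-1- j)) ≈⟨ window-cong N g-split ⟩
        Σ (f 5) ∎

      Σprevious : Σ previous + p * Σ (e 1) ≈ Σ (e 2) + p * p * Σ previous
      Σprevious = begin
        Σ previous + p * Σ (e 1)
          ≈⟨ +-congˡ (*-congˡ (window-reflect₀ N (e 1) (e-vanishes 1 (+ N) L<N) (e-vanishes 1 (ℤ.- + N) L<∣-N∣))) ⟨
        Σ previous + p * Σ (λ j → e 1 (ℤ.- j)) ≈⟨ Σ-linear previous p (λ j → e 1 (ℤ.- j)) ⟨
        Σ (λ j → previous j + p * e 1 (ℤ.- j)) ≈⟨ window-cong N previous-relation ⟩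
        Σ (λ j → e 2 j + p * p * previous j) ≈⟨ Σ-linear (e 2) (p * p) previous ⟩
        Σ (e 2) + p * p * Σ previous ∎

      Σnext : Σ next ≈ Σ (h 2) + (Q * Q * Σ (h 2) + (Q * Σ (h 1) + q * Q * Σ (g 5)))
      Σnext = begin
        Σ next ≈⟨ window-cong N next-split ⟩
        Σ (λ j → h 2 j + (Q * Q * h 2 j + (Q * h 1 (ℤ.- j) + q * Q * g 5 j)))
          ≈⟨ trans (window-+ N (h 2) u) (+-congˡ (trans (window-+ N (λ j → Q * Q * h 2 j) v)
               (+-cong (window-* N (Q * Q) (h 2)) (Σ-linear (λ j → Q * h 1 (ℤ.- j)) (q * Q) (g 5))))) ⟩
        Σ (h 2) + (Q * Q * Σ (h 2) + (Σ (λ j → Q * h 1 (ℤ.- j)) + q * Q * Σ (g 5)))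
          ≈⟨ +-congˡ (+-congˡ (+-congʳ (trans (window-* N Q (λ j → h 1 (ℤ.- j)))
               (*-congˡ (window-reflect₀ N (h 1) (h-vanishes 1 (+ N) L<N) (h-vanishes 1 (ℤ.- + N) L<∣-N∣)))))) ⟩
        Σ (h 2) + (Q * Q * Σ (h 2) + (Q * Σ (h 1) + q * Q * Σ (g 5))) ∎
        where
        u v : ℤ → Carrier
        v j = Q * h 1 (ℤ.- j) + q * Q * g 5 j
        u j = Q * Q * h 2 j + v j

  open Row

  -- Equality of the two sides by induction on `L`.

  next≈ : ∀ L j → next L j ≈ h (suc L) 2 j
  next≈ L j = term-cong 2 {n = y L j ℤ.+ + 2} (lower (+ L) j) (upper (+ L) j) j
    where
    lower : ∀ l j → l ℤ.- + 3 ℤ.* j ℤ.+ 1ℤ ≡ 1ℤ ℤ.+ l ℤ.- + 3 ℤ.* j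
    lower = ℤ-Solver.solve-∀
    upper : ∀ l j → l ℤ.+ + 3 ℤ.* j ℤ.+ + 2 ≡ 1ℤ ℤ.+ l ℤ.+ + 3 ℤ.* j ℤ.+ 1ℤ
    upper = ℤ-Solver.solve-∀

  previous≈ : ∀ L j → previous (suc L) j ≈ h L 2 j
  previous≈ L j = term-cong 2 {n = y (suc L) j} (lower (+ L) j) (upper (+ L) j) j
    where
    lower : ∀ l j → 1ℤ ℤ.+ l ℤ.- + 3 ℤ.* j ℤ.- 1ℤ ≡ l ℤ.- + 3 ℤ.* j
    lower = ℤ-Solver.solve-∀
    upper : ∀ l j → 1ℤ ℤ.+ l ℤ.+ + 3 ℤ.* j ≡ l ℤ.+ + 3 ℤ.* j ℤ.+ 1ℤ
    upper = ℤ-Solver.solve-∀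

  -- `N` is any bound above `L`, so that three consecutive rows can share one window.
  S≈window : ∀ L N → L ℕ.< N → S L ≈ window N (h L 2)
  S≈window zero (suc N) _ = begin
    S 0 ≈⟨ S-zero ⟩
    1# ≈⟨ trans (*-identityˡ _) (trans (*-identityˡ _) (qbinom-+-0ˡ 1)) ⟨
    h 0 2 0ℤ ≈⟨ window-vanishing N (h 0 2) (h-vanishes 0 2) ⟨
    window (suc N) (h 0 2) ∎
  S≈window (suc zero) N 1<N = begin
    S 1 ≈⟨ S-one ⟩
    (1# + q + q ^ 1 * q ^ 1) * S 0 ≈⟨ *-congˡ (S≈window 0 N 0<N) ⟩
    (1# + q + q ^ 1 * q ^ 1) * window N (h 0 2) ≈⟨ first-step ⟨
    window N (next 0) ≈⟨ window-cong N (next≈ 0) ⟩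
    window N (h 1 2) ∎
    where
    0<N = ℕ.<-trans (s≤s z≤n) 1<N
    -- At row 0, p = 1, so the terms in `previous` on the two sides coincide and cancel.
    first-step = +-cancelʳ (q * window N (previous 0)) _ _ (trans (window-recurrence 0 N 0<N)
      (+-congˡ (*-congʳ (trans (*-congˡ (*-identityˡ 1#)) (*-identityʳ q)))))
  S≈window (suc (suc L)) N 2+L<N = +-cancelʳ (q * S L) _ _ (begin
    S (suc (suc L)) + q * S L ≈⟨ S-recurrence L ⟩
    (1# + q + Q₁ * Q₁) * S (suc L) + q * (p₁ * p₁) * S L
      ≈⟨ +-cong (*-congˡ (S≈window (suc L) N 1+L<N)) (*-congˡ S≈previous) ⟩
    (1# + q + Q₁ * Q₁) * window N (h (suc L) 2) + q * (p₁ * p₁) * window N (previous (suc L))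
      ≈⟨ window-recurrence (suc L) N 1+L<N ⟨
    window N (next (suc L)) + q * window N (previous (suc L))
      ≈⟨ +-cong (window-cong N (next≈ (suc L))) (*-congˡ (sym S≈previous)) ⟩
    window N (h (suc (suc L)) 2) + q * S L ∎)
    where
    p₁ = p (suc L)
    Q₁ = Q (suc L)
    1+L<N = ℕ.<-trans (ℕ.n<1+n (suc L)) 2+L<N
    S≈previous : S L ≈ window N (previous (suc L))
    S≈previous = trans (S≈window L N (ℕ.<-trans (ℕ.n<1+n L) 1+L<N)) (sym (window-cong N (previous≈ L)))

  -- Translation to the sums of the theorem.

  summand : ℕ → ℤ → Carrier
  summand L j = (- 1#) ^ ∣ j ∣ * q ^ ∣ + 2 ℤ.* j ℤ.* (+ 3 ℤ.* j ℤ.+ + 1) ∣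
                * qbinom (+ (2 ℕ.* L ℕ.+ 1)) (+ L ℤ.- + 3 ℤ.* j)

  summand≈ : ∀ L j → summand L j ≈ h L 2 j
  summand≈ L j = trans (*-assoc _ _ _) (*-congˡ (*-cong
    (reflexive (≡.cong q^_ (exponent j)))
    (qbinom-+-congʳ (x L j) (complement (+ L) j))))
    where
    exponent : ∀ j → + 2 ℤ.* j ℤ.* (+ 3 ℤ.* j ℤ.+ + 1) ≡ j ℤ.* (+ 6 ℤ.* j ℤ.+ + 2)
    exponent = ℤ-Solver.solve-∀
    complement : ∀ l j → (l ℤ.+ (l ℤ.+ 0ℤ)) ℤ.+ 1ℤ ℤ.- (l ℤ.- + 3 ℤ.* j) ≡ l ℤ.+ + 3 ℤ.* j ℤ.+ 1ℤ
    complement = ℤ-Solver.solve-∀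

  left-hand-side : ∀ L → ∑≤ L (λ k → q ^ T (+ k) * qbinom (+ L) (+ k) * poch (- q) k) ≈ S L
  left-hand-side L = ∑<-cong (suc L) λ k →
    solve 3 (λ a b c → a :* b :* c := a :* c :* b) refl (q ^ T (+ k)) (qbinom (+ L) (+ k)) (poch (- q) k)

  S≈∑ℤ : ∀ L → ∑≤ L (λ k → q ^ T (+ k) * qbinom (+ L) (+ k) * poch (- q) k) ≈∑ℤ summand L
  -- `L` serves as cut-off: beyond it L - 3j or L + 3j + 1 is negative. The window of size L + 1 has
  -- the one extra index -L - 1, where the summand is 0.
  S≈∑ℤ L = L , vanishes , (begin
    ∑≤ L (λ k → q ^ T (+ k) * qbinom (+ L) (+ k) * poch (- q) k) ≈⟨ left-hand-side L ⟩
    S L ≈⟨ S≈window L (suc L) (ℕ.n<1+n L) ⟩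
    window (suc L) (h L 2) ≈⟨ window-cong (suc L) (summand≈ L) ⟨
    window (suc L) (summand L) ≈⟨ ∑±≈window L (summand L) (vanishes -[1+ L ] (ℕ.n<1+n L)) ⟨
    ∑± L (summand L) ∎)
    where
    vanishes : ∀ j → L ℕ.< ∣ j ∣ → summand L j ≈ 0#
    vanishes j L<∣j∣ = trans (summand≈ L j) (h-vanishes L 2 j L<∣j∣)

mainTheorem3 : ∀ {c ℓ} (R : CommutativeRing c ℓ) (q : CommutativeRing.Carrier R) →
    let open CommutativeRing R
        open Pochhammer R q
    in (adm : Admissible) →
    let open QBinomial adm
    in ∀ (L : ℕ) →
    ∑≤ L (λ k → q ^ T (+ k) * qbinom (+ L) (+ k) * poch (- q) k)
    ≈∑ℤ (λ (j : ℤ) →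
          (- 1#) ^ ∣ j ∣
          -- 2j(3j+1) is nonnegative for every integer j
          * q ^ ∣ + 2 ℤ.* j ℤ.* (+ 3 ℤ.* j ℤ.+ + 1) ∣
          * qbinom (+ (2 ℕ.* L ℕ.+ 1)) (+ L ℤ.- + 3 ℤ.* j))
mainTheorem3 R q adm = GaussianBinomials.S≈∑ℤ R q adm
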